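{- For all binary relations $R$ and $S$ on IMP states and all IMP commands $c$ and $c'$, $\vDash \langle R\rangle\ c,\ c'\ \langle S\rangle$ holds if and only if both $\vDash \langle R\rangle\ c,\ \mathbf{skip}\ \langle \mathsf{decomp}(R,c,c',S)\rangle$ and $\vDash \langle \mathsf{decomp}(R,c,c',S)\rangle\ \mathbf{skip},\ c'\ \langle S\rangle$ hold.
   Context: IMP commands: $c ::= x := e \mid c;c \mid \mathbf{if}\ b\ \mathbf{then}\ c\ \mathbf{else}\ c \mid \mathbf{while}\ b\ \mathbf{do}\ c \mid \mathbf{skip}$ over integer arithmetic expressions $e$ and boolean expressions $b$. States map variables to integers; $(c,s)\Rightarrow t$ is the standard big-step semantics of IMP (in particular $(\mathbf{skip},s)\Rightarrow t$ iff $t=s$). Relations are binary relations on states. Under-approximate relational validity: $\vDash \langle R\rangle\ c,\ c'\ \langle S\rangle$ iff $\forall t\,t'.\ S(t,t') \implies \exists s\,s'.\ R(s,s')\land (c,s)\Rightarrow t\land (c',s')\Rightarrow t'$. The relation $\mathsf{decomp}(R,c,c',S)$ is defined by: $\mathsf{decomp}(R,c,c',S)(t,s') \equiv \exists s\,t'.\ R(s,s')\land (c,s)\Rightarrow t\land (c',s')\Rightarrow t'\land S(t,t')$. -}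

module Defs where

open import Data.Nat using (ℕ)
open import Data.Integer using (ℤ; _+_; _-_; _*_; _≤ᵇ_)
open import Data.Bool using (Bool; true; false; not; _∧_)
open import Data.Product using (∃; _×_; _,_)
open import Relation.Binary.PropositionalEquality using (_≡_)

Vname : Set
Vname = ℕ

State : Set
State = Vname → ℤ

data AExp : Set where
  N    : ℤ → AExp
  V    : Vname → AExp
  Plus : AExp → AExp → AExp
  Minus : AExp → AExp → AExp
  Times : AExp → AExp → AExp

aval : AExp → State → ℤ
aval (N n) s = n
aval (V x) s = s x
aval (Plus a b) s = aval a s + aval b s
aval (Minus a b) s = aval a s - aval b s
aval (Times a b) s = aval a s * aval b s

data BExp : Set where
  Bc   : Bool → BExp
  Not  : BExp → BExp
  And  : BExp → BExp → BExp
  Less : AExp → AExp → BExp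

bval : BExp → State → Bool
bval (Bc v) s = v
bval (Not b) s = not (bval b s)
bval (And b₁ b₂) s = bval b₁ s ∧ bval b₂ s
bval (Less a₁ a₂) s = (aval a₁ s Data.Integer.+ Data.Integer.1ℤ) ≤ᵇ aval a₂ s

_[_↦_] : State → Vname → ℤ → State
(s [ x ↦ v ]) y with Data.Nat._≡ᵇ_ x y
... | true = v
... | false = s y

data Com : Set where
  SKIP   : Com
  _::=_  : Vname → AExp → Com
  _⨾_    : Com → Com → Com
  IF_THEN_ELSE_ : BExp → Com → Com → Com
  WHILE_DO_ : BExp → Com → Com

data ⟨_,_⟩⇒_ : Com → State → State → Set where
  Skip : ∀ {s} → ⟨ SKIP , s ⟩⇒ s
  Assign : ∀ {x a s} → ⟨ x ::= a , s ⟩⇒ (s [ x ↦ aval a s ])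
  Seq : ∀ {c₁ c₂ s₁ s₂ s₃} → ⟨ c₁ , s₁ ⟩⇒ s₂ → ⟨ c₂ , s₂ ⟩⇒ s₃ → ⟨ c₁ ⨾ c₂ , s₁ ⟩⇒ s₃
  IfTrue : ∀ {b c₁ c₂ s t} → bval b s ≡ true → ⟨ c₁ , s ⟩⇒ t → ⟨ IF b THEN c₁ ELSE c₂ , s ⟩⇒ t
  IfFalse : ∀ {b c₁ c₂ s t} → bval b s ≡ false → ⟨ c₂ , s ⟩⇒ t → ⟨ IF b THEN c₁ ELSE c₂ , s ⟩⇒ t
  WhileFalse : ∀ {b c s} → bval b s ≡ false → ⟨ WHILE b DO c , s ⟩⇒ s
  WhileTrue : ∀ {b c s₁ s₂ s₃} → bval b s₁ ≡ true → ⟨ c , s₁ ⟩⇒ s₂ →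
              ⟨ WHILE b DO c , s₂ ⟩⇒ s₃ → ⟨ WHILE b DO c , s₁ ⟩⇒ s₃

Rel : Set₁
Rel = State → State → Set

⊨⟨_⟩_,_⟨_⟩ : Rel → Com → Com → Rel → Set
⊨⟨ R ⟩ c , c' ⟨ S ⟩ = ∀ t t' → S t t' →
  ∃ λ s → ∃ λ s' → R s s' × ⟨ c , s ⟩⇒ t × ⟨ c' , s' ⟩⇒ t'

decomp : Rel → Com → Com → Rel → Rel
decomp R c c' S t s' = ∃ λ s → ∃ λ t' → R s s' × ⟨ c , s ⟩⇒ t × ⟨ c' , s' ⟩⇒ t' × S t t'

-- A pair (t, s') lies in decomp R c c' S exactly when it is the midpoint of a witness
-- for ⟨R⟩ c, c' ⟨S⟩: the left program has already run from s to t, the right one has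
-- not yet started. Running c against skip therefore reaches all of decomp from R, and
-- running skip against c' from decomp reaches S precisely when c, c' does from R.
module Submission where

open import Defs
open import Data.Product using (_×_; _,_)
open import Function.Bundles using (_⇔_; mk⇔)

⊨-c-skip-decomp : (R S : Rel) (c c' : Com) →
  ⊨⟨ R ⟩ c , SKIP ⟨ decomp R c c' S ⟩
⊨-c-skip-decomp R S c c' t s' (s , t' , r , c⇒t , _ , _) = s , s' , r , c⇒t , Skip

⊨⇒⊨-decomp-skip : (R S : Rel) (c c' : Com) →
  ⊨⟨ R ⟩ c , c' ⟨ S ⟩ → ⊨⟨ decomp R c c' S ⟩ SKIP , c' ⟨ S ⟩
⊨⇒⊨-decomp-skip R S c c' valid t t' st with valid t t' st
... | s , s' , r , c⇒t , c'⇒t' = t , s' , (s , t' , r , c⇒t , c'⇒t' , st) , Skip , c'⇒t'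

⊨-decomp-skip⇒⊨ : (R S : Rel) (c c' : Com) →
  ⊨⟨ decomp R c c' S ⟩ SKIP , c' ⟨ S ⟩ → ⊨⟨ R ⟩ c , c' ⟨ S ⟩
⊨-decomp-skip⇒⊨ R S c c' valid t t' st with valid t t' st
... | .t , s' , (s , _ , r , c⇒t , _ , _) , Skip , c'⇒t' = s , s' , r , c⇒t , c'⇒t'

lemma1 : (R S : Rel) (c c' : Com) →
    ⊨⟨ R ⟩ c , c' ⟨ S ⟩ ⇔
      (⊨⟨ R ⟩ c , SKIP ⟨ decomp R c c' S ⟩ × ⊨⟨ decomp R c c' S ⟩ SKIP , c' ⟨ S ⟩)
lemma1 R S c c' = mk⇔
  (λ valid → ⊨-c-skip-decomp R S c c' , ⊨⇒⊨-decomp-skip R S c c' valid)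
  (λ (_ , valid) → ⊨-decomp-skip⇒⊨ R S c c' valid)
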